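{- Let $A$ be a finite alphabet. The coloured non-commutative power sum functions $P_I$, indexed by sentences $I$ over $A$, form a linear basis of $\mathrm{NSym}_A$; in particular, for every non-empty word $w$ over $A$, $$H_{(w)}=\sum_{I\preccurlyeq(w)}\frac{1}{\ell(I)!}P_I .$$
   Context: $\Bbbk$ is a field of characteristic zero. A sentence $I=(w_1,\dots,w_m)$ over $A$ is a finite sequence of non-empty words in letters of $A$; $\ell(I)=m$; $1$ is the empty sentence; $I\cdot J$ is concatenation of sequences of words. Write $J\preccurlyeq I$ ($J$ refines $I$) if the words of $I$ can be obtained by concatenating adjacent words of $J$. $\mathrm{NSym}_A$ is the $\Bbbk$-algebra with linear basis $(H_I)$ indexed by sentences over $A$, product $H_IH_J=H_{I\cdot J}$ and unit $H_1=1$. For a non-empty word $w$ define $$P_{(w)}=\sum_{I\preccurlyeq(w)}\frac{(-1)^{\ell(I)-1}}{\ell(I)}H_I,$$ put $P_1=1$ for the empty sentence, and for a non-empty sentence $I=(w_1,\dots,w_{\ell(I)})$ put $P_I=P_{(w_1)}P_{(w_2)}\cdots P_{(w_{\ell(I)})}$. -}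

module Defs where

open import Level using (_⊔_) renaming (suc to lsuc)
open import Algebra.Bundles
open import Algebra.Module.Bundles using (Module)
import Algebra.Definitions as AlgebraDefinitions
import Algebra.Definitions.RawSemiring as RawSemiringOps
open import Algebra.Module.Structures.Biased using (IsModuleFromLeft)
import Algebra.Properties.Ring as RingProperties
import Algebra.Properties.CommutativeSemigroup as CommutativeSemigroupProperties
open import Data.Bool.Base using (if_then_else_; true; false)
open import Data.Fin.Base using (Fin)
import Data.Fin.Properties as Fin
open import Data.List.Base as List using (List; []; _∷_; _++_; map; foldr; filter; cartesianProductWith)
import Data.List.Properties as List
open import Data.List.Membership.Propositional using (_∈_)
open import Data.List.Membership.Propositional.Properties using (∈-map⁺; ∈-map⁻; ∈-++⁺ˡ; ∈-++⁺ʳ; ∈-++⁻)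
open import Data.List.NonEmpty as List⁺ using (List⁺; _∷_; _∷⁺_; toList)
open import Data.List.Relation.Unary.All using (All; []; _∷_)
open import Data.List.Relation.Unary.AllPairs using ([]; _∷_)
open import Data.List.Relation.Unary.Any using (here)
open import Data.List.Relation.Unary.Unique.Propositional using (Unique)
import Data.List.Relation.Unary.Unique.Propositional.Properties as Unique
open import Data.Nat.Base as ℕ using (ℕ; zero; suc; NonZero)
import Data.Nat.Properties as ℕ
open import Data.Product.Base using (∃-syntax; _×_; _,_; proj₁; proj₂; map₁)
open import Data.Sum.Base using (inj₁; inj₂)
open import Function.Bundles using (_↔_; _⇔_; mk⇔)
open import Function.Properties.Inverse using (↔⇒↣)
open import Relation.Binary.Definitions using (DecidableEquality)
open import Relation.Binary.PropositionalEquality as ≡ using (_≡_; _≢_)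
open import Relation.Nullary using (¬_; yes; no; does; ¬?; contradiction)
open import Relation.Nullary.Decidable using (via-injection; map′)

record Field c ℓ : Set (lsuc (c ⊔ ℓ)) where
  field
    commutativeRing : CommutativeRing c ℓ
  open CommutativeRing commutativeRing public
  open AlgebraDefinitions _≈_ using (Invertible)
  field
    1≉0        : ¬ (1# ≈ 0#)
    invertible : ∀ x → ¬ (x ≈ 0#) → Invertible 1# _*_ x
  open RawSemiringOps (Semiring.rawSemiring semiring) public using (_^_) renaming (_×_ to _·_)

CharacteristicZero : ∀ {c ℓ} → Field c ℓ → Set ℓ
CharacteristicZero F = ∀ n → .{{NonZero n}} → ¬ (n · 1# ≈ 0#)
  where open Field F

module _ {r ℓr m ℓm} {R : CommutativeRing r ℓr} (M : Module R m ℓm) where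
  open CommutativeRing R using (Carrier; _≈_; 0#)
  open Module M using (Carrierᴹ; _≈ᴹ_; _+ᴹ_; 0ᴹ; _*ₗ_)

  sumOver : ∀ {i} {I : Set i} → List I → (I → Carrierᴹ) → Carrierᴹ
  sumOver xs f = foldr _+ᴹ_ 0ᴹ (map f xs)

  module _ {i} {I : Set i} (b : I → Carrierᴹ) where

    linearCombination : List (Carrier × I) → Carrierᴹ
    linearCombination cs = sumOver cs λ (c , i) → c *ₗ b i

    Spanning : Set _
    Spanning = ∀ x → ∃[ cs ] x ≈ᴹ linearCombination cs

    -- The indices in cs are pairwise distinct, so that each one occurs
    -- with a single coefficient.
    LinearlyIndependent : Set _
    LinearlyIndependent = ∀ cs → Unique (map proj₂ cs) →
                          linearCombination cs ≈ᴹ 0ᴹ → All (λ (c , _) → c ≈ 0#) cs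

    IsBasis : Set _
    IsBasis = LinearlyIndependent × Spanning

Word : ∀ {a} → Set a → Set a
Word A = List⁺ A

Sentence : ∀ {a} → Set a → Set a
Sentence A = List (Word A)

module _ {a} {A : Set a} where

  -- G splits J into non-empty blocks of adjacent words; concatenating
  -- each block gives I.
  infix 4 _≼_
  _≼_ : Sentence A → Sentence A → Set a
  J ≼ I = ∃[ G ] List.concat (map toList G) ≡ J × map List⁺.concat G ≡ I

  cut glue : A → List⁺ (Word A) → List⁺ (Word A)
  cut  a J        = (a ∷ []) ∷⁺ J
  glue a (v ∷ vs) = (a ∷⁺ v) ∷ vs

  splits : A → List A → List (List⁺ (Word A))
  splits a []       = ((a ∷ []) ∷ []) ∷ []
  splits a (b ∷ bs) = map (cut a) (splits b bs) ++ map (glue a) (splits b bs)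

  -- The sentences I ≼ (w).  They are all non-empty, and are listed as
  -- elements of List⁺ so that ℓ(I) is visibly non-zero.
  refinements : Word A → List (List⁺ (Word A))
  refinements (a ∷ as) = splits a as

  toList-injective : ∀ {B : Set a} {u v : List⁺ B} → toList u ≡ toList v → u ≡ v
  toList-injective ≡.refl = ≡.refl

  ∷-injective⁺ : ∀ {B : Set a} {x y : B} {xs ys} → x List⁺.∷ xs ≡ y ∷ ys → x ≡ y × xs ≡ ys
  ∷-injective⁺ ≡.refl = ≡.refl , ≡.refl

  cut-injective : ∀ {a u v} → cut a u ≡ cut a v → u ≡ v
  cut-injective ≡.refl = ≡.refl

  glue-injective : ∀ {a u v} → glue a u ≡ glue a v → u ≡ v
  glue-injective ≡.refl = ≡.refl

  cut≢glue : ∀ {a u v} → cut a u ≢ glue a v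
  cut≢glue ()

  splits-sound : ∀ a as {g} → g ∈ splits a as → List⁺.concat g ≡ a ∷ as
  splits-sound a []       (here ≡.refl) = ≡.refl
  splits-sound a (b ∷ bs) g∈ with ∈-++⁻ (map (cut a) (splits b bs)) g∈
  ... | inj₁ p with h , h∈ , ≡.refl ← ∈-map⁻ (cut a) p =
    ≡.cong (a ∷⁺_) (splits-sound b bs h∈)
  ... | inj₂ p with h , h∈ , ≡.refl ← ∈-map⁻ (glue a) p =
    ≡.cong (a ∷⁺_) (splits-sound b bs h∈)

  splits-complete : ∀ a as g → List⁺.concat g ≡ a ∷ as → g ∈ splits a as
  splits-complete a [] ((x ∷ []) ∷ []) ≡.refl = here ≡.refl
  splits-complete a [] ((x ∷ []) ∷ (v ∷ vs)) ()
  splits-complete a [] ((x ∷ y ∷ ys) ∷ vs) ()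
  splits-complete a (b ∷ bs) ((x ∷ []) ∷ []) ()
  splits-complete a (b ∷ bs) ((x ∷ []) ∷ (v ∷ vs)) eq with ∷-injective⁺ eq
  ... | ≡.refl , eq′ = ∈-++⁺ˡ (∈-map⁺ (cut x)
          (splits-complete b bs (v ∷ vs) (toList-injective eq′)))
  splits-complete a (b ∷ bs) ((x ∷ y ∷ ys) ∷ vs) eq with ∷-injective⁺ eq
  ... | ≡.refl , eq′ = ∈-++⁺ʳ (map (cut x) (splits b bs)) (∈-map⁺ (glue x)
          (splits-complete b bs ((y ∷ ys) ∷ vs) (toList-injective eq′)))

  splits-unique : ∀ a as → Unique (splits a as)
  splits-unique a []       = [] ∷ []
  splits-unique a (b ∷ bs) =
    Unique.++⁺ (Unique.map⁺ cut-injective (splits-unique b bs))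
               (Unique.map⁺ glue-injective (splits-unique b bs))
               λ (p , q) → disjoint (∈-map⁻ (cut a) p) (∈-map⁻ (glue a) q)
    where
    disjoint : ∀ {x} → (∃[ u ] u ∈ splits b bs × x ≡ cut a u) →
               ¬ (∃[ v ] v ∈ splits b bs × x ≡ glue a v)
    disjoint (_ , _ , ≡.refl) (_ , _ , eq) = cut≢glue eq

  refinements-unique : ∀ w → Unique (refinements w)
  refinements-unique (a ∷ as) = splits-unique a as

  ∈-refinements⇔ : ∀ w J → J ∈ map toList (refinements w) ⇔ J ≼ (w ∷ [])
  ∈-refinements⇔ w@(a ∷ as) J = mk⇔ to from
    where
    to : J ∈ map toList (refinements w) → J ≼ (w ∷ [])
    to p with g , g∈ , ≡.refl ← ∈-map⁻ toList p =
      g ∷ [] , List.++-identityʳ (toList g) , ≡.cong (_∷ []) (splits-sound a as g∈)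

    from : J ≼ (w ∷ []) → J ∈ map toList (refinements w)
    from (g ∷ [] , eq₁ , eq₂) =
      ≡.subst (_∈ map toList (refinements w))
              (≡.trans (≡.sym (List.++-identityʳ (toList g))) eq₁)
              (∈-map⁺ toList (splits-complete a as g (List.∷-injectiveˡ eq₂)))

module ColouredNSym {c ℓ a} (F : Field c ℓ) (char0 : CharacteristicZero F)
                    {A : Set a} {n : ℕ} (finite : A ↔ Fin n) where

  open Field F renaming (Carrier to K)

  recip : ∀ n → .{{NonZero n}} → K
  recip n = proj₁ (invertible (n · 1#) (char0 n))

  infix 4 _≟ᴬ_ _≟_
  _≟ᴬ_ : DecidableEquality A
  _≟ᴬ_ = via-injection (↔⇒↣ finite) Fin._≟_

  _≟_ : DecidableEquality (Sentence A)
  _≟_ = List.≡-dec λ (x ∷ xs) (y ∷ ys) →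
    map′ (λ { ≡.refl → ≡.refl }) (λ { ≡.refl → ≡.refl }) (List.≡-dec _≟ᴬ_ (x ∷ xs) (y ∷ ys))

  -- The free K-module on sentences: formal sums Σ a·H_I, compared by
  -- their coefficients.
  NSym : Set (c ⊔ a)
  NSym = List (K × Sentence A)

  coeff : NSym → Sentence A → K
  coeff []            J = 0#
  coeff ((k , I) ∷ x) J = (if does (I ≟ J) then k else 0#) + coeff x J

  infix 4 _≋_
  record _≋_ (x y : NSym) : Set (ℓ ⊔ a) where
    constructor mk≋
    field coeff≈ : ∀ J → coeff x J ≈ coeff y J
  open _≋_ public

  H : Sentence A → NSym
  H I = (1# , I) ∷ []

  infixr 7 _•_
  infixl 7 _⊛_

  _•_ : K → NSym → NSym
  k • x = map (map₁ (k *_)) x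

  neg : NSym → NSym
  neg x = map (map₁ (-_)) x

  -- The bilinear extension of H_I H_J = H_{I·J}.
  _⊛_ : NSym → NSym → NSym
  _⊛_ = cartesianProductWith λ (k , I) (l , J) → k * l , I ++ J

  private
    open RingProperties ring using (-‿distribˡ-*; -‿+-comm; -0#≈0#; x∙y⁻¹≈ε⇒x≈y; x≈y⇒x∙y⁻¹≈ε)
    open CommutativeSemigroupProperties *-commutativeSemigroup using (x∙yz≈y∙xz)
    open import Relation.Binary.Reasoning.Setoid setoid

  δ : Sentence A → Sentence A → K
  δ J I = if does (I ≟ J) then 1# else 0#

  ⟪_,_⟫ : NSym → (Sentence A → K) → K
  ⟪ [] , f ⟫          = 0#
  ⟪ (k , I) ∷ x , f ⟫ = k * f I + ⟪ x , f ⟫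

  δ-* : ∀ k I J → k * δ J I ≈ (if does (I ≟ J) then k else 0#)
  δ-* k I J with does (I ≟ J)
  ... | true  = *-identityʳ k
  ... | false = zeroʳ k

  coeff-⟪⟫ : ∀ x J → ⟪ x , δ J ⟫ ≈ coeff x J
  coeff-⟪⟫ []            J = refl
  coeff-⟪⟫ ((k , I) ∷ x) J = +-cong (δ-* k I J) (coeff-⟪⟫ x J)

  ⟪⟫-ext : ∀ x {f g} → (∀ I → f I ≈ g I) → ⟪ x , f ⟫ ≈ ⟪ x , g ⟫
  ⟪⟫-ext []            e = refl
  ⟪⟫-ext ((k , I) ∷ x) e = +-cong (*-congˡ (e I)) (⟪⟫-ext x e)

  ⟪⟫-++ : ∀ x y f → ⟪ x ++ y , f ⟫ ≈ ⟪ x , f ⟫ + ⟪ y , f ⟫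
  ⟪⟫-++ []            y f = sym (+-identityˡ _)
  ⟪⟫-++ ((k , I) ∷ x) y f = trans (+-congˡ (⟪⟫-++ x y f)) (sym (+-assoc _ _ _))

  ⟪⟫-• : ∀ k x f → ⟪ k • x , f ⟫ ≈ k * ⟪ x , f ⟫
  ⟪⟫-• k []            f = sym (zeroʳ k)
  ⟪⟫-• k ((l , I) ∷ x) f =
    trans (+-cong (*-assoc k l (f I)) (⟪⟫-• k x f)) (sym (distribˡ k _ _))

  ⟪⟫-neg : ∀ x f → ⟪ neg x , f ⟫ ≈ - ⟪ x , f ⟫
  ⟪⟫-neg []            f = sym -0#≈0#
  ⟪⟫-neg ((l , I) ∷ x) f =
    trans (+-cong (sym (-‿distribˡ-* l (f I))) (⟪⟫-neg x f)) (-‿+-comm _ _)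

  ⟪⟫-+ʳ : ∀ x f g → ⟪ x , (λ I → f I + g I) ⟫ ≈ ⟪ x , f ⟫ + ⟪ x , g ⟫
  ⟪⟫-+ʳ []            f g = sym (+-identityˡ 0#)
  ⟪⟫-+ʳ ((k , I) ∷ x) f g =
    trans (+-cong (distribˡ k (f I) (g I)) (⟪⟫-+ʳ x f g)) (interchange _ _ _ _)
    where open CommutativeSemigroupProperties +-commutativeSemigroup using (interchange)

  ⟪⟫-*ʳ : ∀ x k f → ⟪ x , (λ I → k * f I) ⟫ ≈ k * ⟪ x , f ⟫
  ⟪⟫-*ʳ []            k f = sym (zeroʳ k)
  ⟪⟫-*ʳ ((l , I) ∷ x) k f =
    trans (+-cong (x∙yz≈y∙xz l k (f I)) (⟪⟫-*ʳ x k f)) (sym (distribˡ k _ _))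

  ⟪⟫-map : ∀ k I y f →
    ⟪ map (λ (l , J) → k * l , I ++ J) y , f ⟫ ≈ k * ⟪ y , (λ J → f (I ++ J)) ⟫
  ⟪⟫-map k I []            f = sym (zeroʳ k)
  ⟪⟫-map k I ((l , J) ∷ y) f =
    trans (+-cong (*-assoc k l _) (⟪⟫-map k I y f)) (sym (distribˡ k _ _))

  ⟪⟫-⊛ : ∀ x y f → ⟪ x ⊛ y , f ⟫ ≈ ⟪ x , (λ I → ⟪ y , (λ J → f (I ++ J)) ⟫) ⟫
  ⟪⟫-⊛ []            y f = refl
  ⟪⟫-⊛ ((k , I) ∷ x) y f =
    trans (⟪⟫-++ (map _ y) (x ⊛ y) f) (+-cong (⟪⟫-map k I y f) (⟪⟫-⊛ x y f))

  remove : Sentence A → NSym → NSym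
  remove J = filter (λ t → ¬? (proj₂ t ≟ J))

  ⟪⟫-remove : ∀ J x f → ⟪ x , f ⟫ ≈ coeff x J * f J + ⟪ remove J x , f ⟫
  ⟪⟫-remove J []            f = sym (trans (+-congʳ (zeroˡ _)) (+-identityˡ 0#))
  ⟪⟫-remove J ((k , I) ∷ x) f with I ≟ J
  ... | yes ≡.refl = begin
    k * f J + ⟪ x , f ⟫                                     ≈⟨ +-congˡ (⟪⟫-remove J x f) ⟩
    k * f J + (coeff x J * f J + ⟪ remove J x , f ⟫)        ≈⟨ +-assoc _ _ _ ⟨
    k * f J + coeff x J * f J + ⟪ remove J x , f ⟫          ≈⟨ +-congʳ (distribʳ _ _ _) ⟨
    (k + coeff x J) * f J + ⟪ remove J x , f ⟫              ∎
  ... | no _ = begin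
    k * f I + ⟪ x , f ⟫                                     ≈⟨ +-congˡ (⟪⟫-remove J x f) ⟩
    k * f I + (coeff x J * f J + ⟪ remove J x , f ⟫)        ≈⟨ x∙yz≈y∙xz′ _ _ _ ⟩
    coeff x J * f J + (k * f I + ⟪ remove J x , f ⟫)        ≈⟨ +-congʳ (*-congʳ (+-identityˡ _)) ⟨
    (0# + coeff x J) * f J + (k * f I + ⟪ remove J x , f ⟫) ∎
    where open CommutativeSemigroupProperties +-commutativeSemigroup
            using () renaming (x∙yz≈y∙xz to x∙yz≈y∙xz′)

  coeff-remove : ∀ I x → (∀ J → coeff x J ≈ 0#) → ∀ J → coeff (remove I x) J ≈ 0#
  coeff-remove I x x≈0 J = begin
    coeff (remove I x) J                        ≈⟨ coeff-⟪⟫ (remove I x) J ⟨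
    ⟪ remove I x , δ J ⟫                        ≈⟨ +-identityˡ _ ⟨
    0# + ⟪ remove I x , δ J ⟫                   ≈⟨ +-congʳ (trans (*-congʳ (x≈0 I)) (zeroˡ _)) ⟨
    coeff x I * δ J I + ⟪ remove I x , δ J ⟫    ≈⟨ ⟪⟫-remove I x (δ J) ⟨
    ⟪ x , δ J ⟫                                 ≈⟨ coeff-⟪⟫ x J ⟩
    coeff x J                                   ≈⟨ x≈0 J ⟩
    0#                                          ∎

  remove-head : ∀ k I x → remove I ((k , I) ∷ x) ≡ remove I x
  remove-head k I x with I ≟ I
  ... | yes _ = ≡.refl
  ... | no ¬p = contradiction ≡.refl ¬p

  ⟪⟫-zero : ∀ m x → List.length x ℕ.≤ m → (∀ J → coeff x J ≈ 0#) → ∀ f → ⟪ x , f ⟫ ≈ 0#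
  ⟪⟫-zero m       []              _         x≈0 f = refl
  ⟪⟫-zero (suc m) x′@((k , I) ∷ x) (ℕ.s≤s ≤m) x≈0 f = begin
    ⟪ x′ , f ⟫                              ≈⟨ ⟪⟫-remove I x′ f ⟩
    coeff x′ I * f I + ⟪ remove I x′ , f ⟫  ≈⟨ +-congʳ (trans (*-congʳ (x≈0 I)) (zeroˡ _)) ⟩
    0# + ⟪ remove I x′ , f ⟫                ≈⟨ +-identityˡ _ ⟩
    ⟪ remove I x′ , f ⟫                     ≈⟨ ⟪⟫-zero m (remove I x′) ≤m′ (coeff-remove I x′ x≈0) f ⟩
    0#                                      ∎
    where
    ≤m′ : List.length (remove I x′) ℕ.≤ m
    ≤m′ rewrite remove-head k I x = ℕ.≤-trans (List.length-filter _ x) ≤m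

  ⟪⟫-cong : ∀ {x y} → x ≋ y → ∀ f → ⟪ x , f ⟫ ≈ ⟪ y , f ⟫
  ⟪⟫-cong {x} {y} (mk≋ e) f = x∙y⁻¹≈ε⇒x≈y _ _ (trans (sym (difference f))
    (⟪⟫-zero _ (x ++ neg y) ℕ.≤-refl
      (λ J → trans (sym (coeff-⟪⟫ (x ++ neg y) J))
               (trans (difference (δ J))
                 (x≈y⇒x∙y⁻¹≈ε (trans (coeff-⟪⟫ x J) (trans (e J) (sym (coeff-⟪⟫ y J)))))))
      f))
    where
    difference : ∀ f → ⟪ x ++ neg y , f ⟫ ≈ ⟪ x , f ⟫ - ⟪ y , f ⟫
    difference f = trans (⟪⟫-++ x (neg y) f) (+-congˡ (⟪⟫-neg y f))

  ⟪⟫⇒≋ : ∀ {x y} → (∀ f → ⟪ x , f ⟫ ≈ ⟪ y , f ⟫) → x ≋ y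
  ⟪⟫⇒≋ {x} {y} e = mk≋ λ J → trans (sym (coeff-⟪⟫ x J)) (trans (e (δ J)) (coeff-⟪⟫ y J))

  ++-cong : ∀ {x y u v} → x ≋ y → u ≋ v → x ++ u ≋ y ++ v
  ++-cong {x} {y} {u} {v} p q = ⟪⟫⇒≋ λ f →
    trans (⟪⟫-++ x u f) (trans (+-cong (⟪⟫-cong p f) (⟪⟫-cong q f)) (sym (⟪⟫-++ y v f)))

  ++-comm : ∀ x y → x ++ y ≋ y ++ x
  ++-comm x y = ⟪⟫⇒≋ λ f →
    trans (⟪⟫-++ x y f) (trans (+-comm _ _) (sym (⟪⟫-++ y x f)))

  ≡⇒≋ : ∀ {x y} → x ≡ y → x ≋ y
  ≡⇒≋ ≡.refl = mk≋ λ _ → refl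

  neg-inverseˡ : ∀ x → neg x ++ x ≋ []
  neg-inverseˡ x = ⟪⟫⇒≋ λ f →
    trans (⟪⟫-++ (neg x) x f) (trans (+-congʳ (⟪⟫-neg x f)) (-‿inverseˡ _))

  neg-inverseʳ : ∀ x → x ++ neg x ≋ []
  neg-inverseʳ x = ⟪⟫⇒≋ λ f →
    trans (⟪⟫-++ x (neg x) f) (trans (+-congˡ (⟪⟫-neg x f)) (-‿inverseʳ _))

  neg-cong : ∀ {x y} → x ≋ y → neg x ≋ neg y
  neg-cong {x} {y} p = ⟪⟫⇒≋ λ f →
    trans (⟪⟫-neg x f) (trans (-‿cong (⟪⟫-cong p f)) (sym (⟪⟫-neg y f)))

  •-cong : ∀ {k l x y} → k ≈ l → x ≋ y → k • x ≋ l • y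
  •-cong {k} {l} {x} {y} p q = ⟪⟫⇒≋ λ f →
    trans (⟪⟫-• k x f) (trans (*-cong p (⟪⟫-cong q f)) (sym (⟪⟫-• l y f)))

  ⊛-cong : ∀ {x y u v} → x ≋ y → u ≋ v → x ⊛ u ≋ y ⊛ v
  ⊛-cong {x} {y} {u} {v} p q = ⟪⟫⇒≋ λ f → begin
    ⟪ x ⊛ u , f ⟫                              ≈⟨ ⟪⟫-⊛ x u f ⟩
    ⟪ x , (λ I → ⟪ u , (λ J → f (I ++ J)) ⟫) ⟫ ≈⟨ ⟪⟫-cong p _ ⟩
    ⟪ y , (λ I → ⟪ u , (λ J → f (I ++ J)) ⟫) ⟫ ≈⟨ ⟪⟫-ext y (λ I → ⟪⟫-cong q _) ⟩
    ⟪ y , (λ I → ⟪ v , (λ J → f (I ++ J)) ⟫) ⟫ ≈⟨ ⟪⟫-⊛ y v f ⟨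
    ⟪ y ⊛ v , f ⟫                              ∎

  ⊛-assoc : ∀ x y z → (x ⊛ y) ⊛ z ≋ x ⊛ (y ⊛ z)
  ⊛-assoc x y z = ⟪⟫⇒≋ λ f → begin
    ⟪ (x ⊛ y) ⊛ z , f ⟫
      ≈⟨ ⟪⟫-⊛ (x ⊛ y) z f ⟩
    ⟪ x ⊛ y , (λ I → ⟪ z , (λ L → f (I ++ L)) ⟫) ⟫
      ≈⟨ ⟪⟫-⊛ x y _ ⟩
    ⟪ x , (λ I → ⟪ y , (λ J → ⟪ z , (λ L → f ((I ++ J) ++ L)) ⟫) ⟫) ⟫
      ≈⟨ ⟪⟫-ext x (λ I → ⟪⟫-ext y (λ J → ⟪⟫-ext z (λ L →
           reflexive (≡.cong f (List.++-assoc I J L))))) ⟩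
    ⟪ x , (λ I → ⟪ y , (λ J → ⟪ z , (λ L → f (I ++ (J ++ L))) ⟫) ⟫) ⟫
      ≈⟨ ⟪⟫-ext x (λ I → ⟪⟫-⊛ y z _) ⟨
    ⟪ x , (λ I → ⟪ y ⊛ z , (λ J → f (I ++ J)) ⟫) ⟫
      ≈⟨ ⟪⟫-⊛ x (y ⊛ z) f ⟨
    ⟪ x ⊛ (y ⊛ z) , f ⟫ ∎

  ⊛-identityˡ : ∀ x → H [] ⊛ x ≋ x
  ⊛-identityˡ x = ⟪⟫⇒≋ λ f →
    trans (⟪⟫-⊛ (H []) x f) (trans (+-identityʳ _) (*-identityˡ _))

  ⊛-identityʳ : ∀ x → x ⊛ H [] ≋ x
  ⊛-identityʳ x = ⟪⟫⇒≋ λ f → trans (⟪⟫-⊛ x (H []) f) (⟪⟫-ext x λ I →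
    trans (+-identityʳ _) (trans (*-identityˡ _) (reflexive (≡.cong f (List.++-identityʳ I)))))

  ⊛-distribˡ : ∀ x y z → x ⊛ (y ++ z) ≋ (x ⊛ y) ++ (x ⊛ z)
  ⊛-distribˡ x y z = ⟪⟫⇒≋ λ f → begin
    ⟪ x ⊛ (y ++ z) , f ⟫
      ≈⟨ ⟪⟫-⊛ x (y ++ z) f ⟩
    ⟪ x , (λ I → ⟪ y ++ z , (λ J → f (I ++ J)) ⟫) ⟫
      ≈⟨ ⟪⟫-ext x (λ I → ⟪⟫-++ y z _) ⟩
    ⟪ x , (λ I → ⟪ y , (λ J → f (I ++ J)) ⟫ + ⟪ z , (λ J → f (I ++ J)) ⟫) ⟫
      ≈⟨ ⟪⟫-+ʳ x _ _ ⟩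
    ⟪ x , (λ I → ⟪ y , (λ J → f (I ++ J)) ⟫) ⟫ + ⟪ x , (λ I → ⟪ z , (λ J → f (I ++ J)) ⟫) ⟫
      ≈⟨ +-cong (⟪⟫-⊛ x y f) (⟪⟫-⊛ x z f) ⟨
    ⟪ x ⊛ y , f ⟫ + ⟪ x ⊛ z , f ⟫
      ≈⟨ ⟪⟫-++ (x ⊛ y) (x ⊛ z) f ⟨
    ⟪ (x ⊛ y) ++ (x ⊛ z) , f ⟫ ∎

  ⊛-distribʳ : ∀ x y z → (y ++ z) ⊛ x ≋ (y ⊛ x) ++ (z ⊛ x)
  ⊛-distribʳ x y z = ⟪⟫⇒≋ λ f → begin
    ⟪ (y ++ z) ⊛ x , f ⟫          ≈⟨ ⟪⟫-⊛ (y ++ z) x f ⟩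
    ⟪ y ++ z , _ ⟫                ≈⟨ ⟪⟫-++ y z _ ⟩
    ⟪ y , _ ⟫ + ⟪ z , _ ⟫         ≈⟨ +-cong (⟪⟫-⊛ y x f) (⟪⟫-⊛ z x f) ⟨
    ⟪ y ⊛ x , f ⟫ + ⟪ z ⊛ x , f ⟫ ≈⟨ ⟪⟫-++ (y ⊛ x) (z ⊛ x) f ⟨
    ⟪ (y ⊛ x) ++ (z ⊛ x) , f ⟫    ∎

  •-⊛-assoc : ∀ k x y → (k • x) ⊛ y ≋ k • (x ⊛ y)
  •-⊛-assoc k x y = ⟪⟫⇒≋ λ f →
    trans (⟪⟫-⊛ (k • x) y f) (trans (⟪⟫-• k x _)
      (trans (*-congˡ (sym (⟪⟫-⊛ x y f))) (sym (⟪⟫-• k (x ⊛ y) f))))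

  ⊛-•-comm : ∀ k x y → x ⊛ (k • y) ≋ k • (x ⊛ y)
  ⊛-•-comm k x y = ⟪⟫⇒≋ λ f →
    trans (⟪⟫-⊛ x (k • y) f) (trans (⟪⟫-ext x (λ I → ⟪⟫-• k y _)) (trans (⟪⟫-*ʳ x k _)
      (trans (*-congˡ (sym (⟪⟫-⊛ x y f))) (sym (⟪⟫-• k (x ⊛ y) f)))))

  NSym-ring : Ring (c ⊔ a) (ℓ ⊔ a)
  NSym-ring = record
    { Carrier = NSym ; _≈_ = _≋_ ; _+_ = _++_ ; _*_ = _⊛_ ; -_ = neg ; 0# = [] ; 1# = H []
    ; isRing = record
      { +-isAbelianGroup = record
        { isGroup = record
          { isMonoid = record
            { isSemigroup = record
              { isMagma = record
                { isEquivalence = record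
                  { refl  = mk≋ λ _ → refl
                  ; sym   = λ p → mk≋ λ J → sym (coeff≈ p J)
                  ; trans = λ p q → mk≋ λ J → trans (coeff≈ p J) (coeff≈ q J)
                  }
                ; ∙-cong = ++-cong
                }
              ; assoc = λ x y z → ≡⇒≋ (List.++-assoc x y z)
              }
            ; identity = (λ x → ≡⇒≋ ≡.refl) , (λ x → ≡⇒≋ (List.++-identityʳ x))
            }
          ; inverse = neg-inverseˡ , neg-inverseʳ
          ; ⁻¹-cong = neg-cong
          }
        ; comm = ++-comm
        }
      ; *-cong     = ⊛-cong
      ; *-assoc    = ⊛-assoc
      ; *-identity = ⊛-identityˡ , ⊛-identityʳ
      ; distrib    = ⊛-distribˡ , ⊛-distribʳ
      }
    }

  NSym-module : Module commutativeRing (c ⊔ a) (ℓ ⊔ a)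
  NSym-module = record
    { Carrierᴹ = NSym ; _≈ᴹ_ = _≋_ ; _+ᴹ_ = _++_ ; _*ₗ_ = _•_ ; _*ᵣ_ = λ x k → k • x
    ; 0ᴹ = [] ; -ᴹ_ = neg
    ; isModule = IsModuleFromLeft.isModule {commutativeRing = commutativeRing} record
      { isLeftModule = record
        { isLeftSemimodule = record
          { +ᴹ-isCommutativeMonoid = NSymR.+-isCommutativeMonoid
          ; isPreleftSemimodule = record
            { *ₗ-cong      = •-cong
            ; *ₗ-zeroˡ     = λ x → ⟪⟫⇒≋ λ f → trans (⟪⟫-• 0# x f) (zeroˡ _)
            ; *ₗ-distribʳ  = λ x k l → ⟪⟫⇒≋ λ f →
                trans (⟪⟫-• (k + l) x f) (trans (distribʳ _ k l)
                  (trans (+-cong (sym (⟪⟫-• k x f)) (sym (⟪⟫-• l x f)))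
                    (sym (⟪⟫-++ (k • x) (l • x) f))))
            ; *ₗ-identityˡ = λ x → ⟪⟫⇒≋ λ f → trans (⟪⟫-• 1# x f) (*-identityˡ _)
            ; *ₗ-assoc     = λ k l x → ⟪⟫⇒≋ λ f →
                trans (⟪⟫-• (k * l) x f) (trans (*-assoc k l _)
                  (trans (*-congˡ (sym (⟪⟫-• l x f))) (sym (⟪⟫-• k (l • x) f))))
            ; *ₗ-zeroʳ     = λ k → ≡⇒≋ ≡.refl
            ; *ₗ-distribˡ  = λ k x y → ≡⇒≋ (List.map-++ _ x y)
            }
          }
        ; -ᴹ‿cong    = neg-cong
        ; -ᴹ‿inverse = neg-inverseˡ , neg-inverseʳ
        }
      }
    }
    where module NSymR = Ring NSym-ring

  H-basis : IsBasis NSym-module H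
  H-basis = independent , λ x → x , M.≈ᴹ-sym (combination x)
    where
    module M = Module NSym-module

    combination : ∀ x → linearCombination NSym-module H x ≋ x
    combination []            = M.≈ᴹ-refl
    combination ((k , I) ∷ x) = M.+ᴹ-cong {k • H I} {(k , I) ∷ []}
      (⟪⟫⇒≋ λ f → +-congʳ (*-congʳ (*-identityʳ k))) (combination x)

    absent : ∀ I x → All (I ≢_) (map proj₂ x) → coeff x I ≈ 0#
    absent I []            _        = refl
    absent I ((k , J) ∷ x) (p ∷ ps) with J ≟ I
    ... | yes ≡.refl = contradiction ≡.refl p
    ... | no  _      = trans (+-identityˡ _) (absent I x ps)

    zeros : ∀ x → Unique (map proj₂ x) → x ≋ [] → All (λ (k , _) → k ≈ 0#) x
    zeros []            _        _ = []
    zeros ((k , I) ∷ x) (p ∷ ps) e = k≈0 ∷ zeros x ps x≋0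
      where
      k≈0 : k ≈ 0#
      k≈0 with I ≟ I | coeff≈ e I
      ... | yes _ | e′ = trans (sym (trans (+-congˡ (absent I x p)) (+-identityʳ k))) e′
      ... | no ¬p | _  = contradiction ≡.refl ¬p

      x≋0 : x ≋ []
      x≋0 = M.≈ᴹ-trans (⟪⟫⇒≋ λ f → sym (trans (+-congʳ (trans (*-congʳ k≈0) (zeroˡ _))) (+-identityˡ _))) e

    independent : LinearlyIndependent NSym-module H
    independent cs u e = zeros cs u (M.≈ᴹ-trans (M.≈ᴹ-sym (combination cs)) e)

  H-⊛ : ∀ I J → H I ⊛ H J ≋ H (I ++ J)
  H-⊛ I J = ⟪⟫⇒≋ λ f → +-congʳ (*-congʳ (*-identityˡ 1#))

  P-word : Word A → NSym
  P-word w = sumOver NSym-module (refinements w) λ I →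
    ((- 1#) ^ (List⁺.length I ℕ.∸ 1) * recip (List⁺.length I)) • H (toList I)

  P : Sentence A → NSym
  P I = foldr _⊛_ (H []) (map P-word I)

{-# OPTIONS --safe #-}
-- Everything is tested against functionals: ⟪ x , f ⟫ extends f linearly.
-- Expanding each P_I, a sum over I ≼ (w) of expanded products is a sum over pairs
-- J ≼ (w), G ≼ J, where G groups the words of J into blocks.  With weights 1/ℓ(G)! and
-- (-1)^(n-1)/n per block of size n, the sum over G is the coefficient of x^ℓ(J)
-- in exp (log (1 + x)) = 1 + x, so only J = (w) survives.  Hence the H_I are products
-- of combinations of P's, and P spans.  Independence is triangularity: P_I is H_I plus
-- terms H_J with ℓ(J) > ℓ(I).
module Submission where

open import Defs
open import Algebra.Module.Bundles using (Module)
import Algebra.Properties.CommutativeSemigroup as CommutativeSemigroupProperties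
import Algebra.Properties.Group as GroupProperties
import Algebra.Properties.Ring as RingProperties
import Algebra.Properties.Semiring.Mult as Mult
import Algebra.Solver.Ring.NaturalCoefficients.Default as Solver
open import Data.Fin.Base using (Fin)
open import Data.List.Base as List using (List; []; _∷_; _++_; map; concat)
import Data.List.Properties as List
open import Data.List.Membership.Propositional using (_∈_)
open import Data.List.Membership.Propositional.Properties using (∈-map⁺)
open import Data.List.NonEmpty as List⁺ using (List⁺; _∷_; _∷⁺_; length; toList)
open import Data.List.Relation.Unary.All as All using (All; []; _∷_)
open import Data.List.Relation.Unary.AllPairs using ([]; _∷_)
open import Data.List.Relation.Unary.Any using (here; there)
open import Data.List.Relation.Unary.Unique.Propositional using (Unique)
open import Data.Nat.Base as ℕ using (ℕ; zero; suc; NonZero; _!)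
import Data.Nat.Properties as ℕ
open import Data.Nat.Properties using (_!≢0)
open import Data.Product.Base using (_×_; _,_; proj₁; proj₂; ∃-syntax)
open import Function.Base using (_∘_)
open import Function.Bundles using (_↔_)
open import Relation.Binary.PropositionalEquality as ≡ using (_≡_)
open import Relation.Nullary using (yes; no; contradiction)

-- Finite sums over refinements of words and sentences.

module Sums {c ℓ} (F : Field c ℓ) where

  open Field F renaming (Carrier to K)
  open CommutativeSemigroupProperties +-commutativeSemigroup using (interchange)
  open import Relation.Binary.Reasoning.Setoid setoid

  ∑ : ∀ {i} {I : Set i} → List I → (I → K) → K
  ∑ []       f = 0#
  ∑ (x ∷ xs) f = f x + ∑ xs f

  module _ {i} {I : Set i} where

    ∑-cong-∈ : ∀ (xs : List I) {f g} → (∀ {x} → x ∈ xs → f x ≈ g x) → ∑ xs f ≈ ∑ xs g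
    ∑-cong-∈ []       e = refl
    ∑-cong-∈ (x ∷ xs) e = +-cong (e (here ≡.refl)) (∑-cong-∈ xs (λ x∈ → e (there x∈)))

    ∑-cong : ∀ (xs : List I) {f g} → (∀ x → f x ≈ g x) → ∑ xs f ≈ ∑ xs g
    ∑-cong xs e = ∑-cong-∈ xs λ {x} _ → e x

    ∑-++ : ∀ (xs ys : List I) f → ∑ (xs ++ ys) f ≈ ∑ xs f + ∑ ys f
    ∑-++ []       ys f = sym (+-identityˡ _)
    ∑-++ (x ∷ xs) ys f = trans (+-congˡ (∑-++ xs ys f)) (sym (+-assoc _ _ _))

    ∑-map : ∀ {j} {J : Set j} (h : J → I) ys f → ∑ (map h ys) f ≡ ∑ ys (f ∘ h)
    ∑-map h []       f = ≡.refl
    ∑-map h (y ∷ ys) f = ≡.cong (f (h y) +_) (∑-map h ys f)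

    ∑-+ : ∀ (xs : List I) f g → ∑ xs (λ x → f x + g x) ≈ ∑ xs f + ∑ xs g
    ∑-+ []       f g = sym (+-identityˡ 0#)
    ∑-+ (x ∷ xs) f g = trans (+-congˡ (∑-+ xs f g)) (interchange _ _ _ _)

    ∑-*ˡ : ∀ (xs : List I) k f → ∑ xs (λ x → k * f x) ≈ k * ∑ xs f
    ∑-*ˡ []       k f = sym (zeroʳ k)
    ∑-*ˡ (x ∷ xs) k f = trans (+-congˡ (∑-*ˡ xs k f)) (sym (distribˡ k _ _))

    ∑-zero : ∀ (xs : List I) {f} → (∀ x → f x ≈ 0#) → ∑ xs f ≈ 0#
    ∑-zero []       e = refl
    ∑-zero (x ∷ xs) e = trans (+-cong (e x) (∑-zero xs e)) (+-identityˡ 0#)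

  ∑-splits : ∀ {b} {B : Set b} (x y : B) ys (φ : List⁺ (Word B) → K) →
    ∑ (splits x (y ∷ ys)) φ ≈ ∑ (splits y ys) (φ ∘ cut x) + ∑ (splits y ys) (φ ∘ glue x)
  ∑-splits x y ys φ = trans (∑-++ (map (cut x) S) (map (glue x) S) φ)
    (reflexive (≡.cong₂ _+_ (∑-map (cut x) S φ) (∑-map (glue x) S φ)))
    where S = splits y ys

  -- Every `cut` leaves at least two words, so at each letter only the `glue` branch contributes,
  -- and gluing throughout gives back the whole word.
  ∑-splits-singleton : ∀ {b} {B : Set b} (x : B) xs (φ : List⁺ (Word B) → K) →
    (∀ v u us → φ (v ∷ u ∷ us) ≈ 0#) → ∑ (splits x xs) φ ≈ φ ((x ∷ xs) ∷ [])
  ∑-splits-singleton x []       φ φ≈0 = +-identityʳ _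
  ∑-splits-singleton x (y ∷ ys) φ φ≈0 = begin
    ∑ (splits x (y ∷ ys)) φ
      ≈⟨ ∑-splits x y ys φ ⟩
    ∑ (splits y ys) (φ ∘ cut x) + ∑ (splits y ys) (φ ∘ glue x)
      ≈⟨ +-cong (∑-zero (splits y ys) (λ (v ∷ vs) → φ≈0 (x ∷ []) v vs))
                (∑-splits-singleton y ys (φ ∘ glue x) (λ v → φ≈0 (x ∷⁺ v))) ⟩
    0# + φ ((x ∷ y ∷ ys) ∷ [])
      ≈⟨ +-identityˡ _ ⟩
    φ ((x ∷ y ∷ ys) ∷ []) ∎

  -- The argument of `ψ` keeps one refinement per word instead of the concatenated sentence: it
  -- records both the refined sentence and its grouping into blocks.
  ∑-refine : ∀ {b} {B : Set b} → List (Word B) → (List (List⁺ (Word B)) → K) → K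
  ∑-refine []       ψ = ψ []
  ∑-refine (v ∷ vs) ψ = ∑ (refinements v) λ r → ∑-refine vs λ rs → ψ (r ∷ rs)

  ∑-refine⁺ : ∀ {b} {B : Set b} → List⁺ (Word B) → (List⁺ (List⁺ (Word B)) → K) → K
  ∑-refine⁺ (v ∷ vs) ψ = ∑ (refinements v) λ r → ∑-refine vs λ rs → ψ (r ∷ rs)

  ∑-refine-cong : ∀ {b} {B : Set b} (I : List (Word B)) {φ ψ} →
    (∀ R → φ R ≈ ψ R) → ∑-refine I φ ≈ ∑-refine I ψ
  ∑-refine-cong []       e = e []
  ∑-refine-cong (v ∷ vs) e =
    ∑-cong (refinements v) λ r → ∑-refine-cong vs λ rs → e (r ∷ rs)

  -- Refining each word by one sentence keeps the number of words.
  ∑-refine-length : ∀ {b} {B : Set b} (I : List (Word B)) (g : ℕ → K) ψ →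
    ∑-refine I (λ R → g (List.length R) * ψ R) ≈ g (List.length I) * ∑-refine I ψ
  ∑-refine-length []       g ψ = refl
  ∑-refine-length (v ∷ vs) g ψ = trans
    (∑-cong (refinements v) λ r → ∑-refine-length vs (g ∘ suc) _)
    (∑-*ˡ (refinements v) _ _)

  -- Exchanging the two levels of a double refinement.

  module _ {b} {B : Set b} where

    private
      cutHead glueHead : B → List⁺ (List⁺ (Word B)) → List⁺ (List⁺ (Word B))
      cutHead  a (r ∷ rs) = cut a r ∷ rs
      glueHead a (r ∷ rs) = glue a r ∷ rs

    ∑-refine⁺-cut : ∀ (a : B) I ψ →
      ∑-refine⁺ (cut a I) ψ ≈ ∑-refine⁺ I (ψ ∘ (((a ∷ []) ∷ []) ∷⁺_))
    ∑-refine⁺-cut a (v ∷ vs) ψ = +-identityʳ _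

    ∑-refine⁺-glue : ∀ (a : B) I ψ →
      ∑-refine⁺ (glue a I) ψ ≈ ∑-refine⁺ I (ψ ∘ cutHead a) + ∑-refine⁺ I (ψ ∘ glueHead a)
    ∑-refine⁺-glue a ((x ∷ xs) ∷ vs) ψ = ∑-splits a x xs _

    -- The new one-letter word either forms a block of its own or joins the first block; gluing the
    -- word `a ∷ []` to a grouping is `cutHead a` by definition.
    ∑-refinements-cut : ∀ (a : B) J ψ → ∑ (refinements (cut a J)) ψ ≈
      ∑ (refinements J) (ψ ∘ (((a ∷ []) ∷ []) ∷⁺_)) + ∑ (refinements J) (ψ ∘ cutHead a)
    ∑-refinements-cut a (v ∷ vs) ψ = ∑-splits (a ∷ []) v vs ψ

    -- Lengthening the first word does not affect how the words may be grouped into blocks.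
    ∑-refinements-glue : ∀ (a : B) J ψ →
      ∑ (refinements (glue a J)) ψ ≈ ∑ (refinements J) (ψ ∘ glueHead a)
    ∑-refinements-glue a (v ∷ [])     ψ = refl
    ∑-refinements-glue a (v ∷ u ∷ us) ψ =
      trans (∑-splits (a ∷⁺ v) u us ψ) (sym (∑-splits v u us (ψ ∘ glueHead a)))

    -- Both sides run over two-level groupings of the letters; the left chooses the coarse level
    -- first, the right the fine one. The place after the first letter has three states: a block
    -- ends, only a word ends, or neither. Hence both sides satisfy the same recursion, with terms
    -- `ψ₁`, `ψ₂`, `ψ₃`.
    ∑-refine-twice : ∀ (a : B) as ψ →
      ∑ (splits a as) (λ I → ∑-refine⁺ I ψ) ≈ ∑ (splits a as) (λ J → ∑ (refinements J) ψ)
    ∑-refine-twice a []       ψ = refl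
    ∑-refine-twice a (b ∷ bs) ψ = begin
      ∑ (splits a (b ∷ bs)) (λ I → ∑-refine⁺ I ψ)
        ≈⟨ ∑-splits a b bs _ ⟩
      ∑ S (λ I → ∑-refine⁺ (cut a I) ψ) + ∑ S (λ I → ∑-refine⁺ (glue a I) ψ)
        ≈⟨ +-cong (∑-cong S λ I → ∑-refine⁺-cut a I ψ)
                  (trans (∑-cong S λ I → ∑-refine⁺-glue a I ψ) (∑-+ S _ _)) ⟩
      ∑ S (λ I → ∑-refine⁺ I ψ₁) + (∑ S (λ I → ∑-refine⁺ I ψ₂) + ∑ S (λ I → ∑-refine⁺ I ψ₃))
        ≈⟨ +-cong (∑-refine-twice b bs ψ₁)
                  (+-cong (∑-refine-twice b bs ψ₂) (∑-refine-twice b bs ψ₃)) ⟩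
      D ψ₁ + (D ψ₂ + D ψ₃)
        ≈⟨ +-assoc _ _ _ ⟨
      D ψ₁ + D ψ₂ + D ψ₃
        ≈⟨ +-cong (trans (∑-cong S λ J → ∑-refinements-cut a J ψ) (∑-+ S _ _))
                  (∑-cong S λ J → ∑-refinements-glue a J ψ) ⟨
      ∑ S (λ J → ∑ (refinements (cut a J)) ψ) + ∑ S (λ J → ∑ (refinements (glue a J)) ψ)
        ≈⟨ ∑-splits a b bs _ ⟨
      ∑ (splits a (b ∷ bs)) (λ J → ∑ (refinements J) ψ) ∎
      where
      S = splits b bs
      ψ₁ = ψ ∘ (((a ∷ []) ∷ []) ∷⁺_)
      ψ₂ = ψ ∘ cutHead a
      ψ₃ = ψ ∘ glueHead a
      D = λ (χ : List⁺ (List⁺ (Word B)) → K) → ∑ S λ J → ∑ (refinements J) χ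

-- The identity exp (log (1 + x)) = 1 + x, coefficient by coefficient.

module ExpLog {c ℓ} (F : Field c ℓ) (char0 : CharacteristicZero F) where

  open Field F renaming (Carrier to K)
  open Sums F
  open Mult semiring using (×1-homo-*)
  open Solver commutativeSemiring using (solve; _:+_; _:*_; _:=_; con)
  open GroupProperties +-group using (∙-cancelʳ)
  open RingProperties ring using (-1*x≈-x)
  open import Relation.Binary.Reasoning.Setoid setoid

  -- Unfolds to the same term as `ColouredNSym.recip`, so the results below apply to the
  -- coefficients of `P-word` by definition.
  recip : ∀ n → .{{NonZero n}} → K
  recip n = proj₁ (invertible (n · 1#) (char0 n))

  ι : ℕ → K
  ι n = n · 1#

  ι-*-recip : ∀ n → .{{_ : NonZero n}} → ι n * recip n ≈ 1#
  ι-*-recip n = proj₂ (proj₂ (invertible (n · 1#) (char0 n)))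

  ι-cancel : ∀ n → .{{_ : NonZero n}} → ∀ {x y} → ι n * x ≈ ι n * y → x ≈ y
  ι-cancel n {x} {y} e = trans (sym (absorb x)) (trans (*-congˡ e) (absorb y))
    where
    absorb : ∀ z → recip n * (ι n * z) ≈ z
    absorb z = trans (sym (*-assoc _ _ _))
      (trans (*-congʳ (trans (*-comm _ _) (ι-*-recip n))) (*-identityˡ z))

  σ : ℕ → K
  σ n = (- 1#) ^ n

  σ-suc : ∀ n → σ (suc n) + σ n ≈ 0#
  σ-suc n = trans (+-congʳ (-1*x≈-x (σ n))) (-‿inverseˡ (σ n))

  -- α n is the coefficient of x^(n+1) in log (1 + x), and β n that in exp x - 1.
  α β : ℕ → K
  α n = σ n * recip (suc n)
  β n = recip (suc n !) {{suc n !≢0}}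

  ι-*-α : ∀ n → ι (suc n) * α n ≈ σ n
  ι-*-α n = begin
    ι (suc n) * (σ n * recip (suc n)) ≈⟨ *-congˡ (*-comm _ _) ⟩
    ι (suc n) * (recip (suc n) * σ n) ≈⟨ *-assoc _ _ _ ⟨
    ι (suc n) * recip (suc n) * σ n   ≈⟨ *-congʳ (ι-*-recip (suc n)) ⟩
    1# * σ n                          ≈⟨ *-identityˡ _ ⟩
    σ n                               ∎

  α-zero : α 0 ≈ 1#
  α-zero = trans (sym (trans (*-congʳ (+-identityʳ 1#)) (*-identityˡ _))) (ι-*-α 0)

  β-zero : β 0 ≈ 1#
  β-zero = trans (sym (trans (*-congʳ (+-identityʳ 1#)) (*-identityˡ _))) (ι-*-recip 1)

  -- This is exp′ = exp on coefficients: multiplied by (n + 1)!, both sides become 1.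
  ι-*-β : ∀ n → ι (suc (suc n)) * β (suc n) ≈ β n
  ι-*-β n = ι-cancel (suc n !) {{suc n !≢0}} (begin
    ι (suc n !) * (ι (suc (suc n)) * β (suc n))   ≈⟨ *-assoc _ _ _ ⟨
    ι (suc n !) * ι (suc (suc n)) * β (suc n)     ≈⟨ *-congʳ (*-comm _ _) ⟩
    ι (suc (suc n)) * ι (suc n !) * β (suc n)     ≈⟨ *-congʳ (×1-homo-* (suc (suc n)) (suc n !)) ⟨
    ι (suc (suc n) !) * β (suc n)                 ≈⟨ ι-*-recip (suc (suc n) !) {{suc (suc n) !≢0}} ⟩
    1#                                            ≈⟨ ι-*-recip (suc n !) {{suc n !≢0}} ⟨
    ι (suc n !) * β n                             ∎)

  -- W m f n is the coefficient of x^(n+m+1) in the product of the part of log (1 + x)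
  -- of degree > m with Σ_k f(k) (log (1 + x))^k.
  W : ℕ → (ℕ → K) → ℕ → K
  W m f zero    = α m * f 0
  W m f (suc n) = W (suc m) f n + α m * W 0 (f ∘ suc) n

  W-cong : ∀ m n {f g} → (∀ k → f k ≈ g k) → W m f n ≈ W m g n
  W-cong m zero    e = *-congˡ (e 0)
  W-cong m (suc n) e = +-cong (W-cong (suc m) n e) (*-congˡ (W-cong 0 n (e ∘ suc)))

  W-+ : ∀ m n f g → W m (λ k → f k + g k) n ≈ W m f n + W m g n
  W-+ m zero    f g = distribˡ _ _ _
  W-+ m (suc n) f g = trans
    (+-cong (W-+ (suc m) n f g) (*-congˡ (W-+ 0 n (f ∘ suc) (g ∘ suc))))
    (solve 5 (λ p q a x y → (p :+ q) :+ a :* (x :+ y) := (p :+ a :* x) :+ (q :+ a :* y))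
      refl _ _ _ _ _)

  derivative : (ℕ → K) → ℕ → K
  derivative f k = ι (suc k) * f (suc k)

  -- The Leibniz rule: if f(t) = f(0) + t g(t), then f′ = g + t g′, compared in degree k + 1.
  derivative-shift : ∀ f k →
    f (suc (suc k)) + derivative (f ∘ suc) k ≈ derivative f (suc k)
  derivative-shift f k = sym (trans (distribʳ _ _ _) (+-congʳ (*-identityˡ _)))

  -- The coefficientwise form of (1 + x) (L_m f(L))′ = ± x^m f(L) + L_m f′(L), where
  -- L = log (1 + x) and L_m is its part of degree > m.
  W-derivative : ∀ n m f →
    (ι n + ι m + (1# + 1#)) * W m f (suc n) + (ι n + ι m + 1#) * W m f n
      ≈ σ m * W 0 (f ∘ suc) n + W m (derivative f) n
  W-derivative zero m f = begin
    (0# + M + (1# + 1#)) * (α (suc m) * f 0 + α m * (α 0 * f 1)) + (0# + M + 1#) * (α m * f 0)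
      ≈⟨ +-congʳ (*-congˡ (+-congˡ (*-congˡ f₁))) ⟩
    (0# + M + (1# + 1#)) * (α (suc m) * f 0 + α m * f 1) + (0# + M + 1#) * (α m * f 0)
      ≈⟨ solve 5 (λ M a b x y →
           (con 0 :+ M :+ (con 1 :+ con 1)) :* (b :* x :+ a :* y) :+ (con 0 :+ M :+ con 1) :* (a :* x)
           := ((con 1 :+ (con 1 :+ M)) :* b :+ (con 1 :+ M) :* a) :* x :+ ((con 1 :+ M) :* a :* y :+ a :* y))
           refl M (α m) (α (suc m)) (f 0) (f 1) ⟩
    (ι (suc (suc m)) * α (suc m) + ι (suc m) * α m) * f 0 + (ι (suc m) * α m * f 1 + α m * f 1)
      ≈⟨ +-cong (*-congʳ (trans (+-cong (ι-*-α (suc m)) (ι-*-α m)) (σ-suc m)))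
                (+-congʳ (*-congʳ (ι-*-α m))) ⟩
    0# * f 0 + (σ m * f 1 + α m * f 1)
      ≈⟨ trans (+-congʳ (zeroˡ _)) (+-identityˡ _) ⟩
    σ m * f 1 + α m * f 1
      ≈⟨ +-cong (*-congˡ f₁) (*-congˡ (trans (*-congʳ (+-identityʳ 1#)) (*-identityˡ _))) ⟨
    σ m * (α 0 * f 1) + α m * (ι 1 * f 1) ∎
    where
    M = ι m
    f₁ : α 0 * f 1 ≈ f 1
    f₁ = trans (*-congʳ α-zero) (*-identityˡ _)
  W-derivative (suc n) m f = begin
    (1# + N + M + (1# + 1#)) * (Y₁ + a * X₁) + (1# + N + M + 1#) * (Y₀ + a * X₀)
      -- The integer factors are split in two ways: on the `Y` terms the extra 1 moves into
      -- `ι (suc m)`, to fit the hypothesis at `suc m`; on the `X` terms `ι (suc m)` is separated,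
      -- which leaves the hypothesis at 0 and clears the denominator of `a`.
      ≈⟨ solve 7 (λ N M a Y₁ X₁ Y₀ X₀ →
           (con 1 :+ N :+ M :+ (con 1 :+ con 1)) :* (Y₁ :+ a :* X₁) :+ (con 1 :+ N :+ M :+ con 1) :* (Y₀ :+ a :* X₀)
           := ((N :+ (con 1 :+ M) :+ (con 1 :+ con 1)) :* Y₁ :+ (N :+ (con 1 :+ M) :+ con 1) :* Y₀)
              :+ a :* ((N :+ con 0 :+ (con 1 :+ con 1)) :* X₁ :+ (N :+ con 0 :+ con 1) :* X₀)
              :+ (con 1 :+ M) :* a :* (X₁ :+ X₀))
           refl N M a Y₁ X₁ Y₀ X₀ ⟩
    ((N + ι (suc m) + (1# + 1#)) * Y₁ + (N + ι (suc m) + 1#) * Y₀)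
      + a * ((N + 0# + (1# + 1#)) * X₁ + (N + 0# + 1#) * X₀)
      + ι (suc m) * a * (X₁ + X₀)
      ≈⟨ +-cong (+-cong (W-derivative n (suc m) f) (*-congˡ (W-derivative n 0 (f ∘ suc))))
                (*-congʳ (ι-*-α m)) ⟩
    (σ (suc m) * X₀ + Y′) + a * (1# * V + V′) + σ m * (X₁ + X₀)
      ≈⟨ solve 8 (λ s t X₀ X₁ Y′ a V V′ →
           (s :* X₀ :+ Y′) :+ a :* (con 1 :* V :+ V′) :+ t :* (X₁ :+ X₀)
           := (s :+ t) :* X₀ :+ (t :* X₁ :+ (Y′ :+ a :* (V :+ V′))))
           refl (σ (suc m)) (σ m) X₀ X₁ Y′ a V V′ ⟩
    (σ (suc m) + σ m) * X₀ + (σ m * X₁ + (Y′ + a * (V + V′)))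
      ≈⟨ trans (+-congʳ (trans (*-congʳ (σ-suc m)) (zeroˡ _))) (+-identityˡ _) ⟩
    σ m * X₁ + (Y′ + a * (V + V′))
      ≈⟨ +-congˡ (+-congˡ (*-congˡ (trans (sym (W-+ 0 n _ _)) (W-cong 0 n (derivative-shift f))))) ⟩
    σ m * X₁ + (Y′ + a * W 0 (derivative f ∘ suc) n) ∎
    where
    N  = ι n
    M  = ι m
    a  = α m
    Y₁ = W (suc m) f (suc n)
    Y₀ = W (suc m) f n
    X₁ = W 0 (f ∘ suc) (suc n)
    X₀ = W 0 (f ∘ suc) n
    Y′ = W (suc m) (derivative f) n
    V  = W 0 (f ∘ suc ∘ suc) n
    V′ = W 0 (derivative (f ∘ suc)) n

  -- The differential equation (1 + x) E′ = E satisfied by E = exp (log (1 + x)).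
  W-β-recurrence : ∀ n → ι (suc (suc n)) * W 0 β (suc n) + ι n * W 0 β n ≈ 0#
  -- Adding `W 0 β n` to both sides produces the left side of `W-derivative` at `m = 0`.
  W-β-recurrence n = ∙-cancelʳ (W 0 β n) _ _ (begin
    ι (suc (suc n)) * W 0 β (suc n) + ι n * W 0 β n + W 0 β n
      ≈⟨ solve 3 (λ N p q →
           (con 1 :+ (con 1 :+ N)) :* p :+ N :* q :+ q
           := (N :+ con 0 :+ (con 1 :+ con 1)) :* p :+ (N :+ con 0 :+ con 1) :* q)
           refl (ι n) (W 0 β (suc n)) (W 0 β n) ⟩
    (ι n + 0# + (1# + 1#)) * W 0 β (suc n) + (ι n + 0# + 1#) * W 0 β n
      ≈⟨ W-derivative n 0 β ⟩
    1# * W 0 (β ∘ suc) n + W 0 (derivative β) n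
      ≈⟨ +-congʳ (*-identityˡ _) ⟩
    W 0 (β ∘ suc) n + W 0 (derivative β) n
      ≈⟨ W-+ 0 n _ _ ⟨
    W 0 (λ k → β (suc k) + derivative β k) n
      -- The two coefficients add up to `ι (k + 2) * β (k + 1)`, which is `β k` by the differential
      -- equation of exp.
      ≈⟨ W-cong 0 n (λ k → trans (sym (trans (distribʳ _ _ _) (+-congʳ (*-identityˡ _)))) (ι-*-β k)) ⟩
    W 0 β n
      ≈⟨ +-identityˡ _ ⟨
    0# + W 0 β n ∎)

  W-β-zero : W 0 β 0 ≈ 1#
  W-β-zero = trans (*-cong α-zero β-zero) (*-identityˡ 1#)

  -- The second summand of the recurrence vanishes, for n = 0 because of its factor `ι 0` and later
  -- by induction. Characteristic zero then allows division by n + 2.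
  W-β-suc : ∀ n → W 0 β (suc n) ≈ 0#
  W-β-suc n = ι-cancel (suc (suc n)) (begin
    ι (suc (suc n)) * W 0 β (suc n)                 ≈⟨ +-identityʳ _ ⟨
    ι (suc (suc n)) * W 0 β (suc n) + 0#            ≈⟨ +-congˡ (vanish n) ⟨
    ι (suc (suc n)) * W 0 β (suc n) + ι n * W 0 β n ≈⟨ W-β-recurrence n ⟩
    0#                                              ≈⟨ zeroʳ _ ⟨
    ι (suc (suc n)) * 0#                            ∎)
    where
    vanish : ∀ n → ι n * W 0 β n ≈ 0#
    vanish zero    = zeroˡ _
    vanish (suc n) = trans (*-congˡ (W-β-suc n)) (zeroʳ _)

  -- Weighted sums over groupings, computed by `W`.

  tailLength : ∀ {b} {B : Set b} → List⁺ B → ℕ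
  tailLength = List.length ∘ List⁺.tail

  -- The coefficient of a choice of refinements, one per word, in the expanded product of the
  -- `P-word`s. Using `tailLength` accounts for the index shift in `α`.
  weight : ∀ {b} {B : Set b} → List (List⁺ B) → K
  weight []       = 1#
  weight (g ∷ gs) = α (tailLength g) * weight gs

  -- Read from the left, `m` counts the elements already absorbed into the first block. A `glue`
  -- absorbs one more; a `cut` closes the block, which contributes `α m` and shifts `f`, since one
  -- more block precedes the rest. This is the recursion defining `W`.
  ∑-splits-weight : ∀ {b} {B : Set b} (x : B) xs m f →
    ∑ (splits x xs) (λ (g ∷ gs) → α (tailLength g ℕ.+ m) * (f (List.length gs) * weight gs))
      ≈ W m f (List.length xs)
  ∑-splits-weight x []       m f = trans (+-identityʳ _) (*-congˡ (*-identityʳ _))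
  ∑-splits-weight x (y ∷ ys) m f = begin
    ∑ (splits x (y ∷ ys)) φ
      ≈⟨ ∑-splits x y ys φ ⟩
    ∑ S (φ ∘ cut x) + ∑ S (φ ∘ glue x)
      ≈⟨ +-comm _ _ ⟩
    ∑ S (φ ∘ glue x) + ∑ S (φ ∘ cut x)
      ≈⟨ +-cong
           (∑-cong S λ (g ∷ gs) → *-congʳ (reflexive (≡.cong α (≡.sym (ℕ.+-suc (tailLength g) m)))))
           (trans (∑-cong S λ (g ∷ gs) → *-congˡ (trans (x∙yz≈y∙xz _ _ _)
                     (*-congʳ (reflexive (≡.cong α (≡.sym (ℕ.+-identityʳ (tailLength g))))))))
                  (∑-*ˡ S (α m) _)) ⟩
    ∑ S (λ (g ∷ gs) → α (tailLength g ℕ.+ suc m) * (f (List.length gs) * weight gs))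
      + α m * ∑ S (λ (g ∷ gs) → α (tailLength g ℕ.+ 0) * (f (suc (List.length gs)) * weight gs))
      ≈⟨ +-cong (∑-splits-weight y ys (suc m) f) (*-congˡ (∑-splits-weight y ys 0 (f ∘ suc))) ⟩
    W (suc m) f (List.length ys) + α m * W 0 (f ∘ suc) (List.length ys) ∎
    where
    open CommutativeSemigroupProperties *-commutativeSemigroup using (x∙yz≈y∙xz)
    S = splits y ys
    φ = λ ((g ∷ gs) : List⁺ (List⁺ _)) →
      α (tailLength g ℕ.+ m) * (f (List.length gs) * weight gs)

  ∑-refinements-weight : ∀ {b} {B : Set b} (J : List⁺ B) →
    ∑ (refinements J) (λ G → β (tailLength G) * weight (toList G)) ≈ W 0 β (tailLength J)
  ∑-refinements-weight (x ∷ xs) = trans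
    (∑-cong (splits x xs) λ (g ∷ gs) → trans (x∙yz≈y∙xz _ _ _)
      (*-congʳ (reflexive (≡.cong α (≡.sym (ℕ.+-identityʳ (tailLength g)))))))
    (∑-splits-weight x xs 0 β)
    where open CommutativeSemigroupProperties *-commutativeSemigroup using (x∙yz≈y∙xz)

-- Expanding the P_I in the H_J, and H_(w) in the P_I.

module PowerSums {c ℓ a} (F : Field c ℓ) (char0 : CharacteristicZero F)
                 {A : Set a} {n : ℕ} (finite : A ↔ Fin n) where

  open Field F renaming (Carrier to K)
  open ColouredNSym F char0 finite hiding (recip)
  open Sums F
  open ExpLog F char0
  open import Relation.Binary.Reasoning.Setoid setoid
  private module M = Module NSym-module

  ⟪⟫-sumOver : ∀ {i} {I : Set i} (xs : List I) g f →
    ⟪ sumOver NSym-module xs g , f ⟫ ≈ ∑ xs (λ x → ⟪ g x , f ⟫)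
  ⟪⟫-sumOver []       g f = refl
  ⟪⟫-sumOver (x ∷ xs) g f = trans (⟪⟫-++ (g x) _ f) (+-congˡ (⟪⟫-sumOver xs g f))

  ⟪⟫-H : ∀ I f → ⟪ H I , f ⟫ ≈ f I
  ⟪⟫-H I f = trans (+-identityʳ _) (*-identityˡ _)

  ⟪⟫-P-word : ∀ w f →
    ⟪ P-word w , f ⟫ ≈ ∑ (refinements w) (λ I → α (tailLength I) * f (toList I))
  ⟪⟫-P-word w f = trans (⟪⟫-sumOver (refinements w) _ f)
    (∑-cong (refinements w) λ I → trans (⟪⟫-• _ (H (toList I)) f) (*-congˡ (⟪⟫-H _ f)))

  ⟪⟫-P-∷ : ∀ w I f → ⟪ P (w ∷ I) , f ⟫ ≈
    ∑ (refinements w) (λ R → α (tailLength R) * ⟪ P I , (λ J → f (toList R ++ J)) ⟫)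
  ⟪⟫-P-∷ w I f = trans (⟪⟫-⊛ (P-word w) (P I) f) (⟪⟫-P-word w _)

  ⟪⟫-P : ∀ I f → ⟪ P I , f ⟫ ≈ ∑-refine I (λ R → weight R * f (concat (map toList R)))
  ⟪⟫-P []      f = +-identityʳ _
  ⟪⟫-P (w ∷ I) f = trans (⟪⟫-P-∷ w I f) (∑-cong (refinements w) λ R →
    -- With a constant function, `∑-refine-length` just moves the scalar into the sum.
    trans (*-congˡ (⟪⟫-P I _)) (trans (sym (∑-refine-length I (λ _ → α (tailLength R)) _))
      (∑-refine-cong I λ Rs → sym (*-assoc _ _ _))))

  H-expansion : ∀ w →
    H (w ∷ []) ≋ sumOver NSym-module (refinements w) (λ I → β (tailLength I) • P (toList I))
  H-expansion w@(x ∷ xs) = ⟪⟫⇒≋ λ f → sym (begin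
    ⟪ sumOver NSym-module (refinements w) (λ I → β (tailLength I) • P (toList I)) , f ⟫
      ≈⟨ ⟪⟫-sumOver (refinements w) _ f ⟩
    ∑ (refinements w) (λ I → ⟪ β (tailLength I) • P (toList I) , f ⟫)
      ≈⟨ ∑-cong (refinements w) (expand f) ⟩
    ∑ (refinements w) (λ I → ∑-refine⁺ I (ψ f))
      ≈⟨ ∑-refine-twice x xs (ψ f) ⟩
    ∑ (refinements w) (λ J → ∑ (refinements J) (ψ f))
      ≈⟨ ∑-cong (refinements w) (collect f) ⟩
    ∑ (refinements w) (λ J → W 0 β (tailLength J) * f (toList J))
      ≈⟨ ∑-splits-singleton x xs _ (λ v u us → trans (*-congʳ (W-β-suc (List.length us))) (zeroˡ _)) ⟩
    W 0 β 0 * f (w ∷ [])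
      ≈⟨ trans (*-congʳ W-β-zero) (*-identityˡ _) ⟩
    f (w ∷ [])
      ≈⟨ ⟪⟫-H (w ∷ []) f ⟨
    ⟪ H (w ∷ []) , f ⟫ ∎)
    where
    ψ : (Sentence A → K) → List⁺ (List⁺ (Word A)) → K
    ψ f G = β (tailLength G) * (weight (toList G) * f (concat (map toList (toList G))))

    expand : ∀ f I → ⟪ β (tailLength I) • P (toList I) , f ⟫ ≈ ∑-refine⁺ I (ψ f)
    expand f I = begin
      ⟪ β (tailLength I) • P (toList I) , f ⟫
        ≈⟨ ⟪⟫-• _ (P (toList I)) f ⟩
      β (tailLength I) * ⟪ P (toList I) , f ⟫
        ≈⟨ *-congˡ (⟪⟫-P (toList I) f) ⟩
      β (tailLength I) * ∑-refine (toList I) (λ R → weight R * f (concat (map toList R)))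
        -- There are ℓ(I) chosen refinements, while `β` is indexed by ℓ(I) - 1; hence `ℕ.pred`.
        ≈⟨ ∑-refine-length (toList I) (β ∘ ℕ.pred)
             (λ R → weight R * f (concat (map toList R))) ⟨
      ∑-refine⁺ I (ψ f) ∎

    collect : ∀ f J → ∑ (refinements J) (ψ f) ≈ W 0 β (tailLength J) * f (toList J)
    collect f J@(v ∷ vs) = begin
      ∑ (refinements J) (ψ f)
        -- Concatenating the blocks of any grouping `G` of `J` gives back `J`, so the value of `f`
        -- is a common factor.
        ≈⟨ ∑-cong-∈ (refinements J) (λ {G} G∈ → trans (sym (*-assoc _ _ _)) (trans (*-comm _ _)
             (*-congʳ (reflexive (≡.cong (f ∘ toList) (splits-sound v vs G∈)))))) ⟩
      ∑ (refinements J) (λ G → f (toList J) * (β (tailLength G) * weight (toList G)))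
        ≈⟨ ∑-*ˡ (refinements J) _ _ ⟩
      f (toList J) * ∑ (refinements J) (λ G → β (tailLength G) * weight (toList G))
        ≈⟨ trans (*-congˡ (∑-refinements-weight J)) (*-comm _ _) ⟩
      W 0 β (tailLength J) * f (toList J) ∎

  -- The P_I span.

  ⟪⟫-swap : ∀ x y (f : Sentence A → Sentence A → K) →
    ⟪ x , (λ I → ⟪ y , f I ⟫) ⟫ ≈ ⟪ y , (λ J → ⟪ x , (λ I → f I J) ⟫) ⟫
  ⟪⟫-swap []            y f = sym (trans (⟪⟫-ext y λ J → sym (zeroˡ 0#))
    (trans (⟪⟫-*ʳ y 0# (λ _ → 0#)) (zeroˡ _)))
  ⟪⟫-swap ((k , I) ∷ x) y f = sym (trans (⟪⟫-+ʳ y _ _)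
    (+-cong (⟪⟫-*ʳ y k (f I)) (sym (⟪⟫-swap x y f))))

  P-++ : ∀ I J → P (I ++ J) ≋ P I ⊛ P J
  P-++ []      J = M.≈ᴹ-sym (⊛-identityˡ (P J))
  P-++ (w ∷ I) J = M.≈ᴹ-trans (⊛-cong (M.≈ᴹ-refl {P-word w}) (P-++ I J))
    (M.≈ᴹ-sym (⊛-assoc (P-word w) (P I) (P J)))

  -- An element of NSym, read as a list of coefficients and sentences, also denotes
  -- a combination of the P_I.
  inP : NSym → NSym
  inP = linearCombination NSym-module P

  ⟪⟫-inP : ∀ x f → ⟪ inP x , f ⟫ ≈ ⟪ x , (λ I → ⟪ P I , f ⟫) ⟫
  ⟪⟫-inP []            f = refl
  ⟪⟫-inP ((k , I) ∷ x) f =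
    trans (⟪⟫-++ (k • P I) (inP x) f) (+-cong (⟪⟫-• k (P I) f) (⟪⟫-inP x f))

  -- Replacing H_I by P_I respects products because `P` turns concatenation into multiplication. The
  -- span of the P_I is therefore closed under products.
  inP-⊛ : ∀ x y → inP (x ⊛ y) ≋ inP x ⊛ inP y
  inP-⊛ x y = ⟪⟫⇒≋ λ f → begin
    ⟪ inP (x ⊛ y) , f ⟫
      ≈⟨ ⟪⟫-inP (x ⊛ y) f ⟩
    ⟪ x ⊛ y , (λ I → ⟪ P I , f ⟫) ⟫
      ≈⟨ ⟪⟫-⊛ x y _ ⟩
    ⟪ x , (λ I → ⟪ y , (λ J → ⟪ P (I ++ J) , f ⟫) ⟫) ⟫
      ≈⟨ ⟪⟫-ext x (λ I → ⟪⟫-ext y λ J → trans (⟪⟫-cong (P-++ I J) f) (⟪⟫-⊛ (P I) (P J) f)) ⟩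
    ⟪ x , (λ I → ⟪ y , (λ J → ⟪ P I , (λ I′ → ⟪ P J , (λ J′ → f (I′ ++ J′)) ⟫) ⟫) ⟫) ⟫
      ≈⟨ ⟪⟫-ext x (λ I → ⟪⟫-swap y (P I) _) ⟩
    ⟪ x , (λ I → ⟪ P I , (λ I′ → ⟪ y , (λ J → ⟪ P J , (λ J′ → f (I′ ++ J′)) ⟫) ⟫) ⟫) ⟫
      ≈⟨ ⟪⟫-ext x (λ I → ⟪⟫-ext (P I) λ I′ → sym (⟪⟫-inP y _)) ⟩
    ⟪ x , (λ I → ⟪ P I , (λ I′ → ⟪ inP y , (λ J′ → f (I′ ++ J′)) ⟫) ⟫) ⟫
      ≈⟨ ⟪⟫-inP x _ ⟨
    ⟪ inP x , (λ I′ → ⟪ inP y , (λ J′ → f (I′ ++ J′)) ⟫) ⟫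
      ≈⟨ ⟪⟫-⊛ (inP x) (inP y) f ⟨
    ⟪ inP x ⊛ inP y , f ⟫ ∎

  H-word-in-P : ∀ w → ∃[ x ] H (w ∷ []) ≋ inP x
  H-word-in-P w = map (λ I → β (tailLength I) , toList I) (refinements w) ,
    M.≈ᴹ-trans (H-expansion w) (≡⇒≋ (≡.cong (List.foldr _++_ []) (List.map-∘ (refinements w))))

  H-in-P : ∀ I → ∃[ x ] H I ≋ inP x
  H-in-P []      = H [] , ⟪⟫⇒≋ λ f → sym (trans (⟪⟫-inP (H []) f) (⟪⟫-H [] (λ I → ⟪ P I , f ⟫)))
  H-in-P (w ∷ I) with x , p ← H-word-in-P w | y , q ← H-in-P I =
    x ⊛ y , M.≈ᴹ-trans (M.≈ᴹ-sym (H-⊛ (w ∷ []) I))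
      (M.≈ᴹ-trans (⊛-cong p q) (M.≈ᴹ-sym (inP-⊛ x y)))

  P-spanning : Spanning NSym-module P
  P-spanning []            = [] , M.≈ᴹ-refl
  P-spanning ((k , I) ∷ x) with y , p ← H-in-P I | z , q ← P-spanning x =
    k • y ++ z , ⟪⟫⇒≋ λ f → begin
      k * f I + ⟪ x , f ⟫
        ≈⟨ +-cong (*-congˡ (trans (sym (⟪⟫-H I f)) (trans (⟪⟫-cong p f) (⟪⟫-inP y f))))
                  (trans (⟪⟫-cong q f) (⟪⟫-inP z f)) ⟩
      k * ⟪ y , (λ J → ⟪ P J , f ⟫) ⟫ + ⟪ z , (λ J → ⟪ P J , f ⟫) ⟫
        ≈⟨ +-congʳ (⟪⟫-• k y _) ⟨
      ⟪ k • y , (λ J → ⟪ P J , f ⟫) ⟫ + ⟪ z , (λ J → ⟪ P J , f ⟫) ⟫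
        ≈⟨ ⟪⟫-++ (k • y) z _ ⟨
      ⟪ k • y ++ z , (λ J → ⟪ P J , f ⟫) ⟫
        ≈⟨ ⟪⟫-inP (k • y ++ z) f ⟨
      ⟪ inP (k • y ++ z) , f ⟫ ∎

  -- Triangularity and linear independence.

  -- The vanishing hypothesis passes to the functionals `f (toList R ++ _)`, so the induction leaves
  -- `I` as the tail for each `R`. An `R` with two or more words then makes the sentence too long,
  -- and only the unrefined word remains, with coefficient `α 0` equal to 1.
  P-leading-term : ∀ I f → (∀ J → List.length I ℕ.< List.length J → f J ≈ 0#) →
    ⟪ P I , f ⟫ ≈ f I
  P-leading-term []            f f≈0 = ⟪⟫-H [] f
  P-leading-term (w@(x ∷ xs) ∷ I) f f≈0 = begin
    ⟪ P (w ∷ I) , f ⟫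
      ≈⟨ ⟪⟫-P-∷ w I f ⟩
    ∑ (refinements w) (λ R → α (tailLength R) * ⟪ P I , (λ J → f (toList R ++ J)) ⟫)
      ≈⟨ ∑-cong (refinements w) (λ R → *-congˡ (P-leading-term I _ λ J I<J → f≈0 _
           (ℕ.s≤s (ℕ.≤-trans I<J (longer (List⁺.tail R) J))))) ⟩
    ∑ (refinements w) (λ R → α (tailLength R) * f (toList R ++ I))
      ≈⟨ ∑-splits-singleton x xs _ (λ v u us → trans
           (*-congˡ (f≈0 _ (ℕ.s≤s (ℕ.s≤s (longer us I))))) (zeroʳ _)) ⟩
    α 0 * f (w ∷ I)
      ≈⟨ trans (*-congʳ α-zero) (*-identityˡ _) ⟩
    f (w ∷ I) ∎
    where
    longer : ∀ (u J : Sentence A) → List.length J ℕ.≤ List.length (u ++ J)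
    longer u J = List.length-++-≤ʳ J {xs = u}

  P-triangular : ∀ I J → List.length J ℕ.≤ List.length I → ⟪ P I , δ J ⟫ ≈ δ J I
  P-triangular I J J≤I = P-leading-term I (δ J) vanish
    where
    vanish : ∀ L → List.length I ℕ.< List.length L → δ J L ≈ 0#
    vanish L I<L with L ≟ J
    ... | yes ≡.refl = contradiction J≤I (ℕ.<⇒≱ I<L)
    ... | no  _      = refl

  coeff-∉ : ∀ I x → All (λ J → I ≡.≢ J) (map proj₂ x) → coeff x I ≈ 0#
  coeff-∉ I []            _        = refl
  coeff-∉ I ((k , J) ∷ x) (p ∷ ps) with J ≟ I
  ... | yes ≡.refl = contradiction ≡.refl p
  ... | no  _      = trans (+-identityˡ _) (coeff-∉ I x ps)

  coeff-∈ : ∀ x → Unique (map proj₂ x) → ∀ {k I} → (k , I) ∈ x → coeff x I ≈ k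
  coeff-∈ ((k , I) ∷ x) (p ∷ u) (here ≡.refl) with I ≟ I
  ... | yes _   = trans (+-congˡ (coeff-∉ I x p)) (+-identityʳ k)
  ... | no  I≢I = contradiction ≡.refl I≢I
  coeff-∈ ((l , J) ∷ x) (p ∷ u) {k} {I} (there k∈) with J ≟ I
  ... | yes ≡.refl = contradiction ≡.refl (All.lookup p (∈-map⁺ proj₂ k∈))
  ... | no  _      = trans (+-identityˡ _) (coeff-∈ x u k∈)

  -- Agreement is asked only after multiplication by the coefficients, so `f` and `g` may differ
  -- where the coefficient is zero.
  ⟪⟫-cong-∈ : ∀ x {f g} → (∀ {k I} → (k , I) ∈ x → k * f I ≈ k * g I) →
    ⟪ x , f ⟫ ≈ ⟪ x , g ⟫
  ⟪⟫-cong-∈ []      e = refl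
  ⟪⟫-cong-∈ (_ ∷ x) e = +-cong (e (here ≡.refl)) (⟪⟫-cong-∈ x λ k∈ → e (there k∈))

  P-independent : LinearlyIndependent NSym-module P
  P-independent cs u cs≋0 = All.tabulate λ {(k , I)} → zeros _ ℕ.≤-refl
    where
    zeros : ∀ m {k I} → List.length I ℕ.< m → (k , I) ∈ cs → k ≈ 0#
    zeros (suc m) {k} {I} (ℕ.s≤s I≤m) k∈ = begin
      k                               ≈⟨ coeff-∈ cs u k∈ ⟨
      coeff cs I                      ≈⟨ coeff-⟪⟫ cs I ⟨
      ⟪ cs , δ I ⟫                    ≈⟨ ⟪⟫-cong-∈ cs (λ {l} {J} → agree l J) ⟨
      ⟪ cs , (λ J → ⟪ P J , δ I ⟫) ⟫  ≈⟨ ⟪⟫-inP cs (δ I) ⟨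
      ⟪ inP cs , δ I ⟫                ≈⟨ ⟪⟫-cong cs≋0 (δ I) ⟩
      0#                              ∎
      where
      -- For `J` at least as long as `I`, triangularity gives the entry of the identity matrix; for
      -- shorter `J`, the coefficient is already known to be zero.
      agree : ∀ l J → (l , J) ∈ cs → l * ⟪ P J , δ I ⟫ ≈ l * δ I J
      agree l J l∈ with List.length I ℕ.≤? List.length J
      ... | yes I≤J = *-congˡ (P-triangular J I I≤J)
      ... | no  I≰J = trans (killed _) (sym (killed _))
        where
        killed : ∀ y → l * y ≈ 0#
        killed y = trans (*-congʳ (zeros m (ℕ.<-≤-trans (ℕ.≰⇒> I≰J) I≤m) l∈)) (zeroˡ y)

proposition6p8 : ∀ {c ℓ a} (F : Field c ℓ) (char0 : CharacteristicZero F)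
    {A : Set a} {n} (finite : A ↔ Fin n) →
    let open ColouredNSym F char0 finite in
    IsBasis NSym-module P
    × (∀ (w : Word A) →
    H (w ∷ []) ≋ sumOver NSym-module (refinements w)
    (λ I → recip (length I !) {{length I !≢0}} • P (toList I)))
proposition6p8 F char0 finite = (P-independent , P-spanning) , H-expansion
  where open PowerSums F char0 finite
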